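{- (a) $\mathbb{SMLD}$ is weakly complete for the announcement-free fragment of $\mathcal{L}$: for every $\phi\in\mathcal{L}$ containing no announcement operator $[\cdot]$, if $\mathcal{M},w\vDash\phi$ for every model $\mathcal{M}$ and every world $w$ of $\mathcal{M}$, then $\phi$ is provable in $\mathbb{SMLD}$. (b) $\mathbb{SPALD}$ is weakly complete for the full language $\mathcal{L}$: for every $\phi\in\mathcal{L}$, if $\mathcal{M},w\vDash\phi$ for every model $\mathcal{M}$ and every world $w$ of $\mathcal{M}$, then $\phi$ is provable in $\mathbb{SPALD}$.
   Context: Fix a countable set $\mathsf{Prop}$ of proposition letters and a finite set $I$ of agents. **Language.** The boolean language $\mathcal{L}_B$ is $P ::= p \mid \lnot P \mid (P\land P)$ with $p\in\mathsf{Prop}$. The full language $\mathcal{L}$ is $\phi ::= P \mid P\equiv P \mid \lnot\phi \mid (\phi\land\phi)\mid \Box_i\phi \mid [\phi]\phi$ with $P\in\mathcal{L}_B$, $i\in I$ (the boolean connectives $\lnot,\land$ of the two layers are the same). Abbreviations: $\phi\lor\psi:=\lnot(\lnot\phi\land\lnot\psi)$, $\phi\to\psi:=\lnot\phi\lor\psi$, $\phi\leftrightarrow\psi:=(\phi\to\psi)\land(\psi\to\phi)$, and $P\not\equiv Q:=\lnot(P\equiv Q)$. Parentheses matter: boolean formulas are syntactic objects and $=$ between them is syntactic identity. **Models.** A premodel is $\mathcal{M}=(W,R,V,\mathsf{DEF})$ with $W$ a non-empty set, $R_i\subseteq W\times W$ for each $i\in I$ (no frame conditions), $V\colon W\to\mathsf{Prop}\to\{0,1\}$,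 and $\mathsf{DEF}\colon W\to\mathsf{Prop}\to\mathcal{L}_B$. $V_w$ is extended to $\mathcal{L}_B$ by the usual boolean truth tables. Define $\mathsf{def}_w\colon\mathcal{L}_B\to\mathcal{L}_B$ by $\mathsf{def}_w(p)=\mathsf{DEF}_w(p)$, $\mathsf{def}_w(\lnot P)=\lnot\mathsf{def}_w(P)$, $\mathsf{def}_w((P_1\land P_2))=(\mathsf{def}_w(P_1)\land\mathsf{def}_w(P_2))$. A premodel is a model iff for all worlds $w$: (1) for all $P,Q\in\mathcal{L}_B$, if $\mathsf{def}_w(P)=\mathsf{def}_w(Q)$ then $V_w(P)=V_w(Q)$; (2) for all $p,q\in\mathsf{Prop}$, if $p$ occurs in $\mathsf{DEF}_w(q)$ then $\mathsf{DEF}_w(p)=p$. **Semantics.** $\mathcal{M},w\vDash p$ iff $V_w(p)=1$; $\mathcal{M},w\vDash P_1\equiv P_2$ iff $\mathsf{def}_w(P_1)=\mathsf{def}_w(P_2)$ (syntactic identity); $\lnot,\land$ as usual; $\mathcal{M},w\vDash\Box_i\phi$ iff $\mathcal{M},v\vDash\phi$ for all $v$ with $wR_iv$; $\mathcal{M},w\vDash[\phi]\psi$ iff $\mathcal{M},w\vDash\phi$ implies $\mathcal{M}^\phi,w\vDash\psi$, where $\mathcal{M}^\phi$ is the restriction of $\mathcal{M}$ to $\{v\in W\mid\mathcal{M},v\vDash\phi\}$ (relations, valuation and definitions restricted). **Proof system $\mathbb{SPALD}$.** Axiom schemes ($\phi,\psi,\theta,\xi\in\mathcal{L}$; $P,Q,R,S\in\mathcal{L}_B$;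 $p\in\mathsf{Prop}$; $i\in I$): - all propositional tautologies; - $\Box_i(\phi\to\psi)\to(\Box_i\phi\to\Box_i\psi)$; - PAL reduction axioms: $[\phi]p\leftrightarrow(\phi\to p)$; $[\phi](P\equiv Q)\leftrightarrow(\phi\to(P\equiv Q))$; $[\phi]\lnot\psi\leftrightarrow(\phi\to\lnot[\phi]\psi)$; $[\phi](\psi\land\theta)\leftrightarrow([\phi]\psi\land[\phi]\theta)$; $[\phi]\Box_i\psi\leftrightarrow(\phi\to\Box_i(\phi\to[\phi]\psi))$; $[\phi][\psi]\xi\leftrightarrow[\phi\land[\phi]\psi]\xi$; - definition axioms: reflexivity $P\equiv P$; symmetry $(P\equiv Q)\to(Q\equiv P)$; transitivity $((P\equiv Q)\land(Q\equiv R))\to(P\equiv R)$; equivalence $(P\equiv Q)\to(P\leftrightarrow Q)$; atomic occurrence substitution $((p\equiv Q)\land(R\equiv S))\to(R\equiv[k\mathopen: p\mapsto Q]S)$, where $[k\mathopen: p\mapsto Q]S$ is the result of replacing the $k$-th occurrence of $p$ in $S$ by $Q$; pattern $\lnot$: $(\lnot P\equiv\lnot Q)\leftrightarrow(P\equiv Q)$; pattern $\land$: $((P\land Q)\equiv(R\land S))\leftrightarrow((P\equiv R)\land(Q\equiv S))$; pattern mismatch: $\lnot P\not\equiv(Q\land R)$; non-circularity: $p\not\equiv P$ whenever $p$ occurs in $P$ and $P\neq p$. Rules: modus ponens (from $\phi$ and $\phi\to\psi$ infer $\psi$) and necessitation (from $\vdash\phi$ infer $\vdash\Box_i\phi$).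 **$\mathbb{SMLD}$** is the same system without the PAL reduction axioms. -}

module Defs where

open import Data.Bool.Base using (Bool; true; not; _∧_)
import Data.Irrelevant as Irrelevant
open import Data.Nat.Base using (ℕ; _+_; _∸_)
import Data.Nat.Properties as ℕ
open import Data.Product.Base using (_×_)
open import Data.Refinement.Base using (Refinement; Refinement-syntax; value; _,_)
open import Function.Bundles using (_↣_)
open import Relation.Binary.Definitions using (DecidableEquality)
open import Relation.Binary.PropositionalEquality.Core using (_≡_; _≢_)
open import Relation.Nullary.Decidable using (yes; no; via-injection)
open import Relation.Nullary.Negation.Core using (¬_)
open import Relation.Unary using (Pred; _∪_)
open import Level using (0ℓ)

-- An injection into ℕ witnesses that the set of letters is countable
-- (possibly finite); it is used below only to decide equality of letters.
module Logic (Letter : Set) (countable : Letter ↣ ℕ) (Agent : Set) where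

  _≟_ : DecidableEquality Letter
  _≟_ = via-injection countable ℕ._≟_

  infix  12 ~_
  infixr 10 _&_
  infix  11 _≐_
  infixr 12 [_]_ □

  data BForm : Set where
    atom : Letter → BForm
    ~_   : BForm → BForm
    _&_  : BForm → BForm → BForm

  data Form : Set where
    atom : Letter → Form
    _≐_  : BForm → BForm → Form
    ~_   : Form → Form
    _&_  : Form → Form → Form
    □    : Agent → Form → Form
    [_]_ : Form → Form → Form

  -- The two layers share their boolean connectives, so a boolean formula,
  -- read as a formula of the full language, is its image under ⌜_⌝.
  ⌜_⌝ : BForm → Form
  ⌜ atom p ⌝ = atom p
  ⌜ ~ P ⌝    = ~ ⌜ P ⌝
  ⌜ P & Q ⌝  = ⌜ P ⌝ & ⌜ Q ⌝

  infixr 9 _or_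
  infixr 8 _⇒_
  infix  7 _⇔_
  infix  11 _≠_

  _or_ _⇒_ _⇔_ : Form → Form → Form
  φ or ψ = ~ (~ φ & ~ ψ)
  φ ⇒ ψ  = (~ φ) or ψ
  φ ⇔ ψ  = (φ ⇒ ψ) & (ψ ⇒ φ)

  _≠_ : BForm → BForm → Form
  P ≠ Q = ~ (P ≐ Q)

  data AnnouncementFree : Form → Set where
    atom : ∀ p → AnnouncementFree (atom p)
    _≐_  : ∀ P Q → AnnouncementFree (P ≐ Q)
    ~_   : ∀ {φ} → AnnouncementFree φ → AnnouncementFree (~ φ)
    _&_  : ∀ {φ ψ} → AnnouncementFree φ → AnnouncementFree ψ →
           AnnouncementFree (φ & ψ)
    □    : ∀ i {φ} → AnnouncementFree φ → AnnouncementFree (□ i φ)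

  infix 4 _occursIn_

  data _occursIn_ (p : Letter) : BForm → Set where
    here  : p occursIn atom p
    neg   : ∀ {P} → p occursIn P → p occursIn ~ P
    left  : ∀ {P Q} → p occursIn P → p occursIn P & Q
    right : ∀ {P Q} → p occursIn Q → p occursIn P & Q

  occurrences : Letter → BForm → ℕ
  occurrences p (atom q) with p ≟ q
  ... | yes _ = 1
  ... | no  _ = 0
  occurrences p (~ S)   = occurrences p S
  occurrences p (S & T) = occurrences p S + occurrences p T

  -- Occurrences are numbered from 1, left to right. If k is 0 or exceeds
  -- the number of occurrences, nothing is replaced; hence in a conjunction
  -- at most one of the two recursive calls below changes its argument.
  [_∶_↦_]_ : ℕ → Letter → BForm → BForm → BForm
  [ k ∶ p ↦ Q ] atom q with p ≟ q | k
  ... | yes _ | 1 = Q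
  ... | _     | _ = atom q
  [ k ∶ p ↦ Q ] (~ S)   = ~ [ k ∶ p ↦ Q ] S
  [ k ∶ p ↦ Q ] (S & T) =
    ([ k ∶ p ↦ Q ] S) & ([ k ∸ occurrences p S ∶ p ↦ Q ] T)

  evaluate : (Letter → Bool) → BForm → Bool
  evaluate v (atom p) = v p
  evaluate v (~ P)    = not (evaluate v P)
  evaluate v (P & Q)  = evaluate v P ∧ evaluate v Q

  substitute : (Letter → BForm) → BForm → BForm
  substitute σ (atom p) = σ p
  substitute σ (~ P)    = ~ substitute σ P
  substitute σ (P & Q)  = substitute σ P & substitute σ Q

  -- Non-emptiness is an irrelevant field so that a restriction does not
  -- depend on which surviving world is used to show that one exists.
  record Premodel : Set₁ where
    field
      World     : Set
      .nonEmpty : World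
      R         : Agent → World → World → Set
      V         : World → Letter → Bool
      DEF       : World → Letter → BForm

    val : World → BForm → Bool
    val w = evaluate (V w)

    def : World → BForm → BForm
    def w = substitute (DEF w)

  open Premodel

  record IsModel (M : Premodel) : Set where
    field
      def-val    : ∀ w P Q → def M w P ≡ def M w Q → val M w P ≡ val M w Q
      idempotent : ∀ w p q → p occursIn DEF M w q → DEF M w p ≡ atom p

  -- A refinement type carries its proof irrelevantly, so the new set of
  -- worlds is a genuine subset of the old one.
  restrict : (M : Premodel) (X : Pred (World M) 0ℓ) →
             .(Refinement (World M) X) → Premodel
  restrict M X w = record
    { World    = [ v ∈ World M ∣ X v ]
    ; nonEmpty = w
    ; R        = λ i u v → R M i (value u) (value v)
    ; V        = λ v → V M (value v)
    ; DEF      = λ v → DEF M (value v)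
    }

  infix 4 _at_⊨_

  _at_⊨_ : (M : Premodel) → World M → Form → Set
  M at w ⊨ atom p    = V M w p ≡ true
  M at w ⊨ P ≐ Q     = def M w P ≡ def M w Q
  M at w ⊨ ~ φ       = ¬ (M at w ⊨ φ)
  M at w ⊨ φ & ψ     = (M at w ⊨ φ) × (M at w ⊨ ψ)
  M at w ⊨ □ i φ     = ∀ v → R M i w v → M at v ⊨ φ
  M at w ⊨ ([ φ ] ψ) = (w⊨φ : M at w ⊨ φ) →
    let w′ = w , Irrelevant.[ w⊨φ ]
    in  restrict M (λ v → M at v ⊨ φ) w′ at w′ ⊨ ψ

  Valid : Form → Set₁
  Valid φ = ∀ M → IsModel M → ∀ w → M at w ⊨ φ

  -- Propositional tautologies: every formula whose main operator is not
  -- boolean is treated as a propositional variable.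
  truth : (Form → Bool) → Form → Bool
  truth v (~ φ)   = not (truth v φ)
  truth v (φ & ψ) = truth v φ ∧ truth v ψ
  truth v φ@(atom _)   = v φ
  truth v φ@(_ ≐ _)    = v φ
  truth v φ@(□ _ _)    = v φ
  truth v φ@([ _ ] _)  = v φ

  Tautology : Form → Set
  Tautology φ = ∀ v → truth v φ ≡ true

  data ModalDefinitionAxiom : Form → Set where
    tautology : ∀ {φ} → Tautology φ → ModalDefinitionAxiom φ
    K         : ∀ i φ ψ →
      ModalDefinitionAxiom (□ i (φ ⇒ ψ) ⇒ (□ i φ ⇒ □ i ψ))
    reflexivity  : ∀ P → ModalDefinitionAxiom (P ≐ P)
    symmetry     : ∀ P Q → ModalDefinitionAxiom ((P ≐ Q) ⇒ (Q ≐ P))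
    transitivity : ∀ P Q R →
      ModalDefinitionAxiom (((P ≐ Q) & (Q ≐ R)) ⇒ (P ≐ R))
    equivalence  : ∀ P Q →
      ModalDefinitionAxiom ((P ≐ Q) ⇒ (⌜ P ⌝ ⇔ ⌜ Q ⌝))
    occurrence-substitution : ∀ k p Q R S →
      ModalDefinitionAxiom
        (((atom p ≐ Q) & (R ≐ S)) ⇒ (R ≐ ([ k ∶ p ↦ Q ] S)))
    pattern-~ : ∀ P Q →
      ModalDefinitionAxiom (((~ P) ≐ (~ Q)) ⇔ (P ≐ Q))
    pattern-& : ∀ P Q R S →
      ModalDefinitionAxiom (((P & Q) ≐ (R & S)) ⇔ ((P ≐ R) & (Q ≐ S)))
    pattern-mismatch : ∀ P Q R →
      ModalDefinitionAxiom ((~ P) ≠ (Q & R))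
    non-circularity : ∀ p P → p occursIn P → P ≢ atom p →
      ModalDefinitionAxiom (atom p ≠ P)

  data ReductionAxiom : Form → Set where
    announce-atom : ∀ φ p → ReductionAxiom ([ φ ] (atom p) ⇔ (φ ⇒ atom p))
    announce-≐ : ∀ φ P Q →
      ReductionAxiom ([ φ ] (P ≐ Q) ⇔ (φ ⇒ (P ≐ Q)))
    announce-~ : ∀ φ ψ →
      ReductionAxiom ([ φ ] (~ ψ) ⇔ (φ ⇒ ~ ([ φ ] ψ)))
    announce-& : ∀ φ ψ θ →
      ReductionAxiom ([ φ ] (ψ & θ) ⇔ (([ φ ] ψ) & ([ φ ] θ)))
    announce-□ : ∀ φ i ψ →
      ReductionAxiom ([ φ ] (□ i ψ) ⇔ (φ ⇒ □ i (φ ⇒ ([ φ ] ψ))))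
    announce-announce : ∀ φ ψ ξ →
      ReductionAxiom ([ φ ] ([ ψ ] ξ) ⇔ [ φ & ([ φ ] ψ) ] ξ)

  data Provable (Axiom : Pred Form 0ℓ) : Form → Set where
    axiom         : ∀ {φ} → Axiom φ → Provable Axiom φ
    modus-ponens  : ∀ {φ ψ} → Provable Axiom φ → Provable Axiom (φ ⇒ ψ) →
                    Provable Axiom ψ
    necessitation : ∀ i {φ} → Provable Axiom φ → Provable Axiom (□ i φ)

  infix 3 SMLD⊢_ SPALD⊢_

  SMLD⊢_ SPALD⊢_ : Form → Set
  SMLD⊢ φ  = Provable ModalDefinitionAxiom φ
  SPALD⊢ φ = Provable (ModalDefinitionAxiom ∪ ReductionAxiom) φ

{-# OPTIONS --safe #-}
-- Both parts rest on a dichotomy for announcement-free formulas: each one is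
-- satisfiable or refutable. By induction on modal depth, extend a formula to a
-- stronger context deciding its constituents. Unifying the equations decided
-- true either runs into a mismatch or a circularity, which the definition
-- axioms refute, or yields a most general unifier σ. Take σ for the definitions
-- at the root, read the valuation off the letters occurring in its values, and
-- hang a model supplied by the induction hypothesis below the root for every
-- box decided false.
--
-- Announcements are eliminated from the outside in: if φ is equivalent to an
-- announcement-free formula, so is [ φ ] ψ, by induction on ψ. Composition of
-- announcements then replaces reasoning inside [ φ ]_, for which the calculus
-- has no rule.
module Submission where

open import Defs
open import Data.Bool.Base using (Bool; true; false; not; _∧_)
import Data.Bool.Properties as Bool
open import Data.Empty using (⊥-elim; ⊥-elim-irr)
open import Data.Fin.Base using (Fin)
import Data.Fin.Properties as Fin
import Data.Irrelevant as Irrelevant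
open import Data.List.Base using (List; []; _∷_; _++_; map; concatMap; filter; length)
open import Data.List.Membership.Propositional using (_∈_)
open import Data.List.Membership.Propositional.Properties
  using (∈-++⁺ˡ; ∈-++⁺ʳ; ∈-filter⁺; ∈-concat⁺′; ∈-map⁺)
import Data.List.Membership.DecPropositional as DecMembership
open import Data.List.Properties using (filter-notAll)
open import Data.List.Relation.Unary.All as All using (All; []; _∷_)
import Data.List.Relation.Unary.All.Properties as All
open import Data.List.Relation.Unary.Any as Any using (here; there)
open import Data.Maybe.Base using (Maybe; just; nothing)
open import Data.Nat.Base using (ℕ; zero; suc; _≤_; _<_; s≤s; _⊔_)
import Data.Nat.Properties as ℕ
open import Data.Product.Base using (_×_; Σ; ∃; _,_; proj₁; proj₂; uncurry; map₂)
open import Data.Refinement.Base using (value; _,_)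
open import Data.Sum.Base using (_⊎_; inj₁; inj₂)
open import Function.Base using (_∘_; id; case_of_)
open import Function.Bundles using (_↣_; _↔_)
open import Function.Properties.Inverse using (↔⇒↣)
open import Level using (0ℓ)
open import Relation.Binary.Core using (Rel)
open import Relation.Binary.Definitions using (DecidableEquality)
open import Relation.Binary.PropositionalEquality
  using (_≡_; _≢_; refl; sym; trans; cong; cong₂; subst)
open import Relation.Nullary.Decidable
  using (Dec; yes; no; does; map′; via-injection; decidable-stable; ¬?)
open import Relation.Nullary.Negation.Core using (¬_; contradiction)
open import Relation.Unary using (Pred; _∪_)

-- Boolean formulas, substitutions and structural congruences.

module BooleanFormulas (Letter : Set) (countable : Letter ↣ ℕ) (Agent : Set) where
  open Logic Letter countable Agent

  ~-injective : ∀ {P Q : BForm} → ~ P ≡ ~ Q → P ≡ Q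
  ~-injective refl = refl

  &-injectiveˡ : ∀ {P Q P′ Q′ : BForm} → P & Q ≡ P′ & Q′ → P ≡ P′
  &-injectiveˡ refl = refl

  &-injectiveʳ : ∀ {P Q P′ Q′ : BForm} → P & Q ≡ P′ & Q′ → Q ≡ Q′
  &-injectiveʳ refl = refl

  _≟ᴮ_ : DecidableEquality BForm
  atom p  ≟ᴮ atom q    = map′ (cong atom) (λ { refl → refl }) (p ≟ q)
  (~ P)   ≟ᴮ (~ Q)     = map′ (cong ~_) ~-injective (P ≟ᴮ Q)
  (P & Q) ≟ᴮ (P′ & Q′) with P ≟ᴮ P′ | Q ≟ᴮ Q′
  ... | yes refl | yes refl = yes refl
  ... | no P≢P′  | _        = no (P≢P′ ∘ &-injectiveˡ)
  ... | _        | no Q≢Q′  = no (Q≢Q′ ∘ &-injectiveʳ)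
  atom _  ≟ᴮ (~ _)   = no λ ()
  atom _  ≟ᴮ (_ & _) = no λ ()
  (~ _)   ≟ᴮ atom _  = no λ ()
  (~ _)   ≟ᴮ (_ & _) = no λ ()
  (_ & _) ≟ᴮ atom _  = no λ ()
  (_ & _) ≟ᴮ (~ _)   = no λ ()

  letters : BForm → List Letter
  letters (atom p) = p ∷ []
  letters (~ P)    = letters P
  letters (P & Q)  = letters P ++ letters Q

  occursIn⇒∈letters : ∀ {p P} → p occursIn P → p ∈ letters P
  occursIn⇒∈letters here              = here refl
  occursIn⇒∈letters (neg o)           = occursIn⇒∈letters o
  occursIn⇒∈letters (left o)          = ∈-++⁺ˡ (occursIn⇒∈letters o)
  occursIn⇒∈letters (right {P} {Q} o) = ∈-++⁺ʳ (letters P) (occursIn⇒∈letters o)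

  occursIn? : ∀ p P → Dec (p occursIn P)
  occursIn? p (atom q) = map′ (λ { refl → here }) (λ { here → refl }) (p ≟ q)
  occursIn? p (~ P)    = map′ neg (λ { (neg o) → o }) (occursIn? p P)
  occursIn? p (P & Q) with occursIn? p P | occursIn? p Q
  ... | yes o | _     = yes (left o)
  ... | no _  | yes o = yes (right o)
  ... | no ¬P | no ¬Q = no λ { (left o) → ¬P o ; (right o) → ¬Q o }

  substitute-∘ : ∀ σ τ P →
    substitute (substitute σ ∘ τ) P ≡ substitute σ (substitute τ P)
  substitute-∘ σ τ (atom p) = refl
  substitute-∘ σ τ (~ P)    = cong ~_ (substitute-∘ σ τ P)
  substitute-∘ σ τ (P & Q)  = cong₂ _&_ (substitute-∘ σ τ P) (substitute-∘ σ τ Q)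

  evaluate-substitute : ∀ v σ P →
    evaluate (evaluate v ∘ σ) P ≡ evaluate v (substitute σ P)
  evaluate-substitute v σ (atom p) = refl
  evaluate-substitute v σ (~ P)    = cong not (evaluate-substitute v σ P)
  evaluate-substitute v σ (P & Q)  =
    cong₂ _∧_ (evaluate-substitute v σ P) (evaluate-substitute v σ Q)

  -- An idempotent substitution leaves its own values unchanged, hence fixes every letter occurring
  -- in them. This yields the second model condition when such a substitution serves as the
  -- definitions of a world.
  substitute-fixed : ∀ {σ p} P → substitute σ P ≡ P → p occursIn P → σ p ≡ atom p
  substitute-fixed (atom p) eq here      = eq
  substitute-fixed (~ P)    eq (neg o)   = substitute-fixed P (~-injective eq) o
  substitute-fixed (P & Q)  eq (left o)  = substitute-fixed P (&-injectiveˡ eq) o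
  substitute-fixed (P & Q)  eq (right o) = substitute-fixed Q (&-injectiveʳ eq) o

  _↦_ : Letter → BForm → Letter → BForm
  (p ↦ T) q with p ≟ q
  ... | yes _ = T
  ... | no _  = atom q

  ↦-same : ∀ p T → (p ↦ T) p ≡ T
  ↦-same p T with p ≟ p
  ... | yes _  = refl
  ... | no p≢p = contradiction refl p≢p

  ↦-fresh : ∀ {p T} P → ¬ p occursIn P → substitute (p ↦ T) P ≡ P
  ↦-fresh {p} (atom q) p∉P with p ≟ q
  ... | yes refl = contradiction here p∉P
  ... | no _     = refl
  ↦-fresh (~ P)   p∉P = cong ~_ (↦-fresh P (p∉P ∘ neg))
  ↦-fresh (P & Q) p∉P = cong₂ _&_ (↦-fresh P (p∉P ∘ left)) (↦-fresh Q (p∉P ∘ right))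

  -- The occurs check on `T` makes `p` vanish, so unification can continue with strictly fewer
  -- letters.
  ↦-eliminates : ∀ {p T x} P → ¬ p occursIn T → x occursIn substitute (p ↦ T) P →
    p ≢ x × (x occursIn P ⊎ x occursIn T)
  ↦-eliminates {p} (atom q) p∉T o with p ≟ q
  ↦-eliminates (atom q) p∉T o    | yes refl = (λ { refl → p∉T o }) , inj₂ o
  ↦-eliminates (atom q) p∉T here | no p≢q   = p≢q , inj₁ here
  ↦-eliminates (~ P) p∉T (neg o) with ↦-eliminates P p∉T o
  ... | p≢x , inj₁ o′ = p≢x , inj₁ (neg o′)
  ... | p≢x , inj₂ o′ = p≢x , inj₂ o′
  ↦-eliminates (P & Q) p∉T (left o) with ↦-eliminates P p∉T o
  ... | p≢x , inj₁ o′ = p≢x , inj₁ (left o′)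
  ... | p≢x , inj₂ o′ = p≢x , inj₂ o′
  ↦-eliminates (P & Q) p∉T (right o) with ↦-eliminates Q p∉T o
  ... | p≢x , inj₁ o′ = p≢x , inj₁ (right o′)
  ... | p≢x , inj₂ o′ = p≢x , inj₂ o′

  -- The two instances needed are the kernel of a substitution and provable
  -- definitional equality in a context.
  record StructuralCongruence (_≈_ : Rel BForm 0ℓ) : Set where
    field
      ≈-refl  : ∀ {P} → P ≈ P
      ≈-sym   : ∀ {P Q} → P ≈ Q → Q ≈ P
      ≈-trans : ∀ {P Q S} → P ≈ Q → Q ≈ S → P ≈ S
      ~-cong  : ∀ {P Q} → P ≈ Q → (~ P) ≈ (~ Q)
      &-cong  : ∀ {P Q P′ Q′} → P ≈ P′ → Q ≈ Q′ → (P & Q) ≈ (P′ & Q′)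
      ~-inj   : ∀ {P Q} → (~ P) ≈ (~ Q) → P ≈ Q
      &-injˡ  : ∀ {P Q P′ Q′} → (P & Q) ≈ (P′ & Q′) → P ≈ P′
      &-injʳ  : ∀ {P Q P′ Q′} → (P & Q) ≈ (P′ & Q′) → Q ≈ Q′

    ≈-substitute : ∀ {σ} → (∀ q → atom q ≈ σ q) → ∀ P → P ≈ substitute σ P
    ≈-substitute q≈σq (atom q) = q≈σq q
    ≈-substitute q≈σq (~ P)    = ~-cong (≈-substitute q≈σq P)
    ≈-substitute q≈σq (P & Q)  = &-cong (≈-substitute q≈σq P) (≈-substitute q≈σq Q)

    -- Every formula is congruent to its own instance, so formulas with the same instance are
    -- congruent. For provable equality this turns syntactic identity under a unifier into a
    -- derivation.
    ≈-reflect : ∀ {σ} → (∀ q → atom q ≈ σ q) → ∀ P Q →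
      substitute σ P ≡ substitute σ Q → P ≈ Q
    ≈-reflect q≈σq P Q eq =
      ≈-trans (≈-substitute q≈σq P)
              (≈-trans (subst (_ ≈_) eq ≈-refl) (≈-sym (≈-substitute q≈σq Q)))

  open StructuralCongruence

  Kernel : (Letter → BForm) → Rel BForm 0ℓ
  Kernel σ P Q = substitute σ P ≡ substitute σ Q

  kernel-congruence : ∀ σ → StructuralCongruence (Kernel σ)
  kernel-congruence σ = record
    { ≈-refl  = refl
    ; ≈-sym   = sym
    ; ≈-trans = trans
    ; ~-cong  = cong ~_
    ; &-cong  = cong₂ _&_
    ; ~-inj   = ~-injective
    ; &-injˡ  = &-injectiveˡ
    ; &-injʳ  = &-injectiveʳ
    }

  -- Syntactic unification with occurs check.

  data Clash (_≈_ : Rel BForm 0ℓ) : Set where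
    mismatch : ∀ {P Q S} → (~ P) ≈ (Q & S) → Clash _≈_
    circular : ∀ {p P} → p occursIn P → P ≢ atom p → atom p ≈ P → Clash _≈_

  Equations : Set
  Equations = List (BForm × BForm)

  -- Generality is stated for all structural congruences at once. For the kernel of a substitution
  -- it says that the substitution absorbs the unifier, as in the usual definition; for provable
  -- equality it says that each letter is provably equal to its value.
  record MostGeneralUnifier (E : Equations) : Set₁ where
    field
      unifier : Letter → BForm
      unifies : All (uncurry (Kernel unifier)) E
      general : ∀ {_≈_} → StructuralCongruence _≈_ → All (uncurry _≈_) E →
                ∀ q → atom q ≈ unifier q

    unifier-idempotent : ∀ q → substitute unifier (unifier q) ≡ unifier q
    unifier-idempotent q = sym (general (kernel-congruence unifier) unifies q)

  open MostGeneralUnifier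

  Clashing : Equations → Set₁
  Clashing E = ∀ {_≈_} → StructuralCongruence _≈_ → All (uncurry _≈_) E → Clash _≈_

  Outcome : Equations → Set₁
  Outcome E = Clashing E ⊎ MostGeneralUnifier E

  _Entails_ : Equations → Equations → Set₁
  E Entails E′ = ∀ {_≈_} → StructuralCongruence _≈_ →
                 All (uncurry _≈_) E → All (uncurry _≈_) E′

  transfer : ∀ {E E′} → E Entails E′ → E′ Entails E → Outcome E′ → Outcome E
  transfer to from (inj₁ clash) = inj₁ λ C E≈ → clash C (to C E≈)
  transfer to from (inj₂ mgu)   = inj₂ record
    { unifier = unifier mgu
    ; unifies = from (kernel-congruence _) (unifies mgu)
    ; general = λ C E≈ → general mgu C (to C E≈)
    }

  _⊑_ : BForm → List Letter → Set
  P ⊑ U = ∀ {x} → x occursIn P → x ∈ U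

  Within : List Letter → Equations → Set
  Within U = All λ (P , Q) → P ⊑ U × Q ⊑ U

  remove : Letter → List Letter → List Letter
  remove p = filter (λ x → ¬? (p ≟ x))

  length-remove : ∀ {p U} → p ∈ U → length (remove p U) < length U
  length-remove p∈U = filter-notAll _ _ (Any.map (λ p≡x p≢x → p≢x p≡x) p∈U)

  substitute-⊑ : ∀ {p T U} P → ¬ p occursIn T → T ⊑ U → P ⊑ U →
    substitute (p ↦ T) P ⊑ remove p U
  substitute-⊑ P p∉T T⊑U P⊑U o with ↦-eliminates P p∉T o
  ... | p≢x , inj₁ o′ = ∈-filter⁺ _ (P⊑U o′) p≢x
  ... | p≢x , inj₂ o′ = ∈-filter⁺ _ (T⊑U o′) p≢x

  substituteᴱ : (Letter → BForm) → Equations → Equations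
  substituteᴱ σ = map λ (P , Q) → substitute σ P , substitute σ Q

  -- Where `p ≈ T` holds, every formula is congruent to its instance under `p ↦ T`, so clashes and
  -- generality carry over from the substituted equations. The composite unifies `p` with `T`
  -- because `p ↦ T` fixes `T`.
  eliminate : ∀ {p T} E → ¬ p occursIn T → Outcome (substituteᴱ (p ↦ T) E) →
    Outcome ((atom p , T) ∷ E)
  eliminate {p} {T} E p∉T = λ where
      (inj₁ clash) → inj₁ λ where
        C (p≈T ∷ E≈) → clash C (substituteᴱ-≈ C p≈T E≈)
      (inj₂ mgu) → inj₂ record
        { unifier = substitute (unifier mgu) ∘ (p ↦ T)
        ; unifies = unifies-p mgu ∷ All.map (λ {(P , Q)} → unifies-E mgu P Q) (All.map⁻ (unifies mgu))
        ; general = λ where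
            C (p≈T ∷ E≈) q → ≈-trans C (p↦T-≈ C p≈T q)
              (≈-substitute C (general mgu C (substituteᴱ-≈ C p≈T E≈)) ((p ↦ T) q))
        }
    where
    p↦T-≈ : ∀ {_≈_} → StructuralCongruence _≈_ → atom p ≈ T →
      ∀ q → atom q ≈ (p ↦ T) q
    p↦T-≈ C p≈T q with p ≟ q
    ... | yes refl = p≈T
    ... | no _     = ≈-refl C

    substituteᴱ-≈ : ∀ {_≈_} → StructuralCongruence _≈_ → atom p ≈ T →
      All (uncurry _≈_) E → All (uncurry _≈_) (substituteᴱ (p ↦ T) E)
    substituteᴱ-≈ C p≈T E≈ = All.map⁺ (All.map (λ {(P , Q)} P≈Q →
      ≈-trans C (≈-sym C (≈-substitute C (p↦T-≈ C p≈T) P))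
                (≈-trans C P≈Q (≈-substitute C (p↦T-≈ C p≈T) Q))) E≈)

    unifies-E : ∀ mgu P Q →
      Kernel (unifier mgu) (substitute (p ↦ T) P) (substitute (p ↦ T) Q) →
      Kernel (substitute (unifier mgu) ∘ (p ↦ T)) P Q
    unifies-E mgu P Q eq =
      trans (substitute-∘ (unifier mgu) (p ↦ T) P)
            (trans eq (sym (substitute-∘ (unifier mgu) (p ↦ T) Q)))

    unifies-p : ∀ mgu → Kernel (substitute (unifier mgu) ∘ (p ↦ T)) (atom p) T
    unifies-p mgu =
      trans (cong (substitute (unifier mgu)) (trans (↦-same p T) (sym (↦-fresh T p∉T))))
            (sym (substitute-∘ (unifier mgu) (p ↦ T) T))

  -- Decomposing P and Q leaves the letters U unchanged, so the outcome for the
  -- remaining equations is handed to unify₁ instead of being computed by it;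
  -- this makes unify₁ structurally recursive in P.
  unify-within : ∀ n U → length U < n → ∀ E → Within U E → Outcome E
  unify₁ : ∀ n U → length U < suc n → ∀ P Q E → P ⊑ U → Q ⊑ U → Within U E →
    Outcome E → Outcome ((P , Q) ∷ E)
  unify-letter : ∀ n U → length U < suc n → ∀ p T E → p ∈ U → T ⊑ U → Within U E →
    Outcome E → Outcome ((atom p , T) ∷ E)

  unify-within zero U () E E⊑U
  unify-within (suc n) U <n [] [] = inj₂ record
    { unifier = atom ; unifies = [] ; general = λ C _ q → ≈-refl C }
  unify-within (suc n) U <n ((P , Q) ∷ E) ((P⊑U , Q⊑U) ∷ E⊑U) =
    unify₁ n U <n P Q E P⊑U Q⊑U E⊑U (unify-within (suc n) U <n E E⊑U)

  unify₁ n U <n (atom p) Q E P⊑U Q⊑U E⊑U rest =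
    unify-letter n U <n p Q E (P⊑U here) Q⊑U E⊑U rest
  unify₁ n U <n P@(~ _) (atom q) E P⊑U Q⊑U E⊑U rest = transfer
    (λ { C (P≈q ∷ E≈) → ≈-sym C P≈q ∷ E≈ })
    (λ { C (q≈P ∷ E≈) → ≈-sym C q≈P ∷ E≈ })
    (unify-letter n U <n q P E (Q⊑U here) P⊑U E⊑U rest)
  unify₁ n U <n P@(_ & _) (atom q) E P⊑U Q⊑U E⊑U rest = transfer
    (λ { C (P≈q ∷ E≈) → ≈-sym C P≈q ∷ E≈ })
    (λ { C (q≈P ∷ E≈) → ≈-sym C q≈P ∷ E≈ })
    (unify-letter n U <n q P E (Q⊑U here) P⊑U E⊑U rest)
  unify₁ n U <n (~ P) (~ Q) E P⊑U Q⊑U E⊑U rest = transfer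
    (λ { C (eq ∷ E≈) → ~-inj C eq ∷ E≈ })
    (λ { C (eq ∷ E≈) → ~-cong C eq ∷ E≈ })
    (unify₁ n U <n P Q E (P⊑U ∘ neg) (Q⊑U ∘ neg) E⊑U rest)
  unify₁ n U <n (P & Q) (P′ & Q′) E P⊑U Q⊑U E⊑U rest = transfer
    (λ { C (eq ∷ E≈) → &-injˡ C eq ∷ &-injʳ C eq ∷ E≈ })
    (λ { C (eq₁ ∷ eq₂ ∷ E≈) → &-cong C eq₁ eq₂ ∷ E≈ })
    (unify₁ n U <n P P′ ((Q , Q′) ∷ E) (P⊑U ∘ left) (Q⊑U ∘ left)
      ((P⊑U ∘ right , Q⊑U ∘ right) ∷ E⊑U)
      (unify₁ n U <n Q Q′ E (P⊑U ∘ right) (Q⊑U ∘ right) E⊑U rest))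
  unify₁ n U <n (~ _) (_ & _) E P⊑U Q⊑U E⊑U rest =
    inj₁ λ { C (eq ∷ _) → mismatch eq }
  unify₁ n U <n (_ & _) (~ _) E P⊑U Q⊑U E⊑U rest =
    inj₁ λ { C (eq ∷ _) → mismatch (≈-sym C eq) }

  unify-letter n U <n p T E p∈U T⊑U E⊑U rest with T ≟ᴮ atom p | occursIn? p T
  ... | yes refl | _       = transfer (λ { C (_ ∷ E≈) → E≈ }) (λ C E≈ → ≈-refl C ∷ E≈) rest
  ... | no T≢p   | yes p∈T = inj₁ λ { C (p≈T ∷ _) → circular p∈T T≢p p≈T }
  -- Deleting `p` from `U` lowers its length, which permits the call with the smaller bound `n`.
  ... | no _     | no p∉T  = eliminate E p∉T
    (unify-within n (remove p U) (ℕ.<-≤-trans (length-remove p∈U) (ℕ.≤-pred <n)) _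
      (All.map⁺ (All.map (λ {(P , Q)} (P⊑U , Q⊑U) →
        substitute-⊑ P p∉T T⊑U P⊑U , substitute-⊑ Q p∉T T⊑U Q⊑U) E⊑U)))

  unify : ∀ E → Outcome E
  unify E = unify-within _ (concatMap lettersᴱ E) ℕ.≤-refl E
      (All.tabulate λ {(P , Q)} PQ∈E →
          (λ o → ∈-concat⁺′ (∈-++⁺ˡ (occursIn⇒∈letters o)) (∈-map⁺ lettersᴱ PQ∈E))
        , (λ o → ∈-concat⁺′ (∈-++⁺ʳ (letters P) (occursIn⇒∈letters o)) (∈-map⁺ lettersᴱ PQ∈E)))
    where
    lettersᴱ : BForm × BForm → List Letter
    lettersᴱ (P , Q) = letters P ++ letters Q

-- Derived rules, for any axioms that include the modal and definition axioms.

module Derivations (Letter : Set) (countable : Letter ↣ ℕ) (Agent : Set)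
  {Axiom : Pred (Logic.Form Letter countable Agent) 0ℓ}
  (include : ∀ {φ} → Logic.ModalDefinitionAxiom Letter countable Agent φ → Axiom φ) where

  open Logic Letter countable Agent
  open BooleanFormulas Letter countable Agent

  infix  3 ⊢_ _⊩_
  infixl 5 _·_

  ⊢_ : Form → Set
  ⊢_ = Provable Axiom

  _⊩_ : Form → Form → Set
  Γ ⊩ φ = ⊢ Γ ⇒ φ

  definitional : ∀ {φ} → ModalDefinitionAxiom φ → ⊢ φ
  definitional = axiom ∘ include

  -- The truth function of `_⇒_` with its abbreviations unfolded, so that the side conditions of the
  -- tautology lemmas hold by `refl`.
  _→ᵇ_ : Bool → Bool → Bool
  a →ᵇ b = not (not (not a) ∧ not b)

  infixr 4 _→ᵇ_

  every : (Bool → Bool) → Bool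
  every f = f true ∧ f false

  every-sound : ∀ f → every f ≡ true → ∀ b → f b ≡ true
  every-sound f eq true  = Bool.∧-conicalˡ _ _ eq
  every-sound f eq false = Bool.∧-conicalʳ (f true) _ eq

  truth-table : (f : Bool → Bool → Bool → Bool) →
    (every λ a → every λ b → every λ c → f a b c) ≡ true →
    ∀ a b c → f a b c ≡ true
  truth-table f eq a b =
    every-sound (f a b) (every-sound (λ b → every (f a b))
      (every-sound (λ a → every λ b → every (f a b)) eq a) b)

  tautology₂ : (f : Bool → Bool → Bool) →
    (every λ a → every λ b → every λ _ → f a b) ≡ true →
    ∀ {χ} φ ψ → (∀ v → truth v χ ≡ f (truth v φ) (truth v ψ)) → ⊢ χ
  tautology₂ f eq φ ψ χ≡f = definitional (tautology λ v →
    trans (χ≡f v) (truth-table (λ a b _ → f a b) eq (truth v φ) (truth v ψ) true))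

  tautology₃ : (f : Bool → Bool → Bool → Bool) →
    (every λ a → every λ b → every λ c → f a b c) ≡ true →
    ∀ {χ} φ ψ θ → (∀ v → truth v χ ≡ f (truth v φ) (truth v ψ) (truth v θ)) → ⊢ χ
  tautology₃ f eq φ ψ θ χ≡f = definitional (tautology λ v →
    trans (χ≡f v) (truth-table f eq (truth v φ) (truth v ψ) (truth v θ)))

  variable
    Γ Δ φ ψ θ χ : Form

  by₁ : ⊢ φ ⇒ ψ → ⊢ φ → ⊢ ψ
  by₁ d e = modus-ponens e d

  by₂ : ⊢ φ ⇒ ψ ⇒ θ → ⊢ φ → ⊢ ψ → ⊢ θ
  by₂ d e = by₁ (by₁ d e)

  weaken : ⊢ φ → Γ ⊩ φ
  weaken {φ} {Γ} = by₁ (tautology₂ (λ a b → a →ᵇ b →ᵇ a) refl φ Γ λ _ → refl)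

  _·_ : Γ ⊩ φ ⇒ ψ → Γ ⊩ φ → Γ ⊩ ψ
  _·_ {Γ} {φ} {ψ} = by₂ (tautology₃
    (λ a b c → (a →ᵇ b →ᵇ c) →ᵇ (a →ᵇ b) →ᵇ a →ᵇ c) refl Γ φ ψ λ _ → refl)

  assumption : Γ ⊩ Γ
  assumption {Γ} = tautology₂ (λ a _ → a →ᵇ a) refl Γ Γ λ _ → refl

  _∙_ : Γ ⊩ φ → Δ ⊩ Γ → Δ ⊩ φ
  d ∙ e = weaken d · e

  &-elimˡ : φ & ψ ⊩ φ
  &-elimˡ {φ} {ψ} = tautology₂ (λ a b → a ∧ b →ᵇ a) refl φ ψ λ _ → refl

  &-elimʳ : φ & ψ ⊩ ψ
  &-elimʳ {φ} {ψ} = tautology₂ (λ a b → a ∧ b →ᵇ b) refl φ ψ λ _ → refl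

  &-intro : Γ ⊩ φ → Γ ⊩ ψ → Γ ⊩ φ & ψ
  &-intro {Γ} {φ} {ψ} d e =
    weaken (tautology₂ (λ a b → a →ᵇ b →ᵇ a ∧ b) refl φ ψ λ _ → refl) · d · e

  ~~-intro : φ ⊩ ~ ~ φ
  ~~-intro {φ} = tautology₂ (λ a _ → a →ᵇ not (not a)) refl φ φ λ _ → refl

  ~~-elim : ~ ~ φ ⊩ φ
  ~~-elim {φ} = tautology₂ (λ a _ → not (not a) →ᵇ a) refl φ φ λ _ → refl

  contrapositive : φ ⊩ ψ → ~ ψ ⊩ ~ φ
  contrapositive {φ} {ψ} = by₁ (tautology₂
    (λ a b → (a →ᵇ b) →ᵇ not b →ᵇ not a) refl φ ψ λ _ → refl)

  ~&-introˡ : ~ φ ⊩ ~ (φ & ψ)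
  ~&-introˡ = contrapositive &-elimˡ

  ~&-introʳ : ~ ψ ⊩ ~ (φ & ψ)
  ~&-introʳ = contrapositive &-elimʳ

  ~&-elim : ~ (φ & ψ) ⊩ φ ⇒ ~ ψ
  ~&-elim {φ} {ψ} = tautology₂
    (λ a b → not (a ∧ b) →ᵇ a →ᵇ not b) refl φ ψ λ _ → refl

  modus-tollens : Γ ⊩ φ ⇒ ψ → Γ ⊩ ~ ψ → Γ ⊩ ~ φ
  modus-tollens {Γ} {φ} {ψ} d e = weaken (tautology₂
    (λ a b → (a →ᵇ b) →ᵇ not b →ᵇ not a) refl φ ψ λ _ → refl) · d · e

  inconsistent : Γ ⊩ φ → Γ ⊩ ~ φ → ⊢ ~ Γ
  inconsistent {Γ} {φ} = by₂ (tautology₂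
    (λ a b → (a →ᵇ b) →ᵇ (a →ᵇ not b) →ᵇ not a) refl Γ φ λ _ → refl)

  cases : ⊢ ~ (Γ & φ) → ⊢ ~ (Γ & (~ φ)) → ⊢ ~ Γ
  cases {Γ} {φ} = by₂ (tautology₂
    (λ a b → not (a ∧ b) →ᵇ not (a ∧ not b) →ᵇ not a) refl Γ φ λ _ → refl)

  _⊣⊢_ : Form → Form → Set
  φ ⊣⊢ ψ = (φ ⊩ ψ) × (ψ ⊩ φ)

  from-⇔ : ⊢ φ ⇔ ψ → φ ⊣⊢ ψ
  from-⇔ d = by₁ &-elimˡ d , by₁ &-elimʳ d

  □-map : ∀ {i} → φ ⊩ ψ → □ i φ ⊩ □ i ψ
  □-map {i = i} d = by₁ (definitional (K i _ _)) (necessitation i d)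

  □-ap : ∀ {i} → Γ ⊩ □ i (φ ⇒ ψ) → Γ ⊩ □ i φ → Γ ⊩ □ i ψ
  □-ap d e = weaken (definitional (K _ _ _)) · d · e

  -- This lets unification act on provable equations: the two directions of each pattern axiom give
  -- congruence and injectivity of the connective.
  provable-congruence : ∀ Γ → StructuralCongruence (λ P Q → Γ ⊩ P ≐ Q)
  provable-congruence Γ = record
    { ≈-refl  = weaken (definitional (reflexivity _))
    ; ≈-sym   = λ d → definitional (symmetry _ _) ∙ d
    ; ≈-trans = λ d e → definitional (transitivity _ _ _) ∙ &-intro d e
    ; ~-cong  = λ d → proj₂ pattern~ ∙ d
    ; &-cong  = λ d e → proj₂ pattern& ∙ &-intro d e
    ; ~-inj   = λ d → proj₁ pattern~ ∙ d
    ; &-injˡ  = λ d → &-elimˡ ∙ (proj₁ pattern& ∙ d)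
    ; &-injʳ  = λ d → &-elimʳ ∙ (proj₁ pattern& ∙ d)
    }
    where
    pattern~ : ∀ {P Q} → ((~ P) ≐ (~ Q)) ⊣⊢ (P ≐ Q)
    pattern~ = from-⇔ (definitional (pattern-~ _ _))

    pattern& : ∀ {P Q S T} → ((P & Q) ≐ (S & T)) ⊣⊢ ((P ≐ S) & (Q ≐ T))
    pattern& = from-⇔ (definitional (pattern-& _ _ _ _))

  clash-refutes : Clash (λ P Q → Γ ⊩ P ≐ Q) → ⊢ ~ Γ
  clash-refutes (mismatch d) =
    inconsistent d (weaken (definitional (pattern-mismatch _ _ _)))
  clash-refutes (circular p∈P P≢p d) =
    inconsistent d (weaken (definitional (non-circularity _ _ p∈P P≢p)))

  -- Deciding finitely many formulas in a context.

  record Verdict {A : Set} (Γ : Form) (f : A → Form) (L : List A) : Set where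
    field
      accepted : List A
      rejected : List A
      accepts  : All (λ a → Γ ⊩ f a) accepted
      rejects  : All (λ a → Γ ⊩ ~ f a) rejected
      covers   : All (λ a → a ∈ accepted ⊎ a ∈ rejected) L

  open Verdict

  strengthen : ∀ {A f} {L : List A} → Δ ⊩ Γ → Verdict Γ f L → Verdict Δ f L
  strengthen d V = record
    { accepted = accepted V
    ; rejected = rejected V
    ; accepts  = All.map (_∙ d) (accepts V)
    ; rejects  = All.map (_∙ d) (rejects V)
    ; covers   = covers V
    }

  -- Case distinction on one formula at a time: the first success is returned, and if both
  -- extensions of the context are refuted, then excluded middle refutes the context itself. The
  -- continuation receives the extended context and may decide further formulas there.
  decide-all : ∀ {A : Set} {C : Set₁} (f : A → Form) L Γ →
    (∀ Δ → Δ ⊩ Γ → Verdict Δ f L → C ⊎ (⊢ ~ Δ)) → C ⊎ (⊢ ~ Γ)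
  decide-all f [] Γ k = k Γ assumption record
    { accepted = [] ; rejected = [] ; accepts = [] ; rejects = [] ; covers = [] }
  decide-all {C = C} f (a ∷ L) Γ k =
    case decide-all f L (Γ & f a) accept of λ where
      (inj₁ c) → inj₁ c
      (inj₂ d) → case decide-all f L (Γ & (~ f a)) reject of λ where
        (inj₁ c) → inj₁ c
        (inj₂ e) → inj₂ (cases d e)
    where
    accept : ∀ Δ → Δ ⊩ Γ & f a → Verdict Δ f L → C ⊎ (⊢ ~ Δ)
    accept Δ d V = k Δ (&-elimˡ ∙ d) record
      { accepted = a ∷ accepted V
      ; rejected = rejected V
      ; accepts  = (&-elimʳ ∙ d) ∷ accepts V
      ; rejects  = rejects V
      ; covers   = inj₁ (here refl) ∷
          All.map (λ { (inj₁ a∈) → inj₁ (there a∈) ; (inj₂ a∈) → inj₂ a∈ }) (covers V)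
      }

    reject : ∀ Δ → Δ ⊩ Γ & (~ f a) → Verdict Δ f L → C ⊎ (⊢ ~ Δ)
    reject Δ d V = k Δ (&-elimˡ ∙ d) record
      { accepted = accepted V
      ; rejected = a ∷ rejected V
      ; accepts  = accepts V
      ; rejects  = (&-elimʳ ∙ d) ∷ rejects V
      ; covers   = inj₂ (here refl) ∷
          All.map (λ { (inj₁ a∈) → inj₁ a∈ ; (inj₂ a∈) → inj₂ (there a∈) }) (covers V)
      }

-- Stability of satisfaction and invariance under bisimulation.

module Semantics (Letter : Set) (countable : Letter ↣ ℕ) (Agent : Set) where
  open Logic Letter countable Agent
  open BooleanFormulas Letter countable Agent
  open Premodel

  -- Satisfaction need not be decidable, since boxes range over arbitrary sets of worlds. It is
  -- however built from decidable statements by negations, products and function spaces, which all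
  -- preserve stability under double negation.
  stable : ∀ M φ {w} → ¬ ¬ (M at w ⊨ φ) → M at w ⊨ φ
  stable M (atom p)  = decidable-stable (_ Bool.≟ _)
  stable M (P ≐ Q)   = decidable-stable (_ ≟ᴮ _)
  stable M (~ φ)     = λ nn a → nn λ n → n a
  stable M (φ & ψ)   = λ nn →
    stable M φ (λ n → nn (n ∘ proj₁)) , stable M ψ (λ n → nn (n ∘ proj₂))
  stable M (□ i φ)   = λ nn v r → stable M φ λ n → nn λ h → n (h v r)
  stable M ([ φ ] ψ) = λ nn a → stable _ ψ λ n → nn λ h → n (h a)

  -- Worlds of a restriction carry their proof of survival irrelevantly. Stability recovers a usable
  -- proof, because a contradiction may be drawn from irrelevant evidence.
  recompute : ∀ M φ {w} → .(M at w ⊨ φ) → M at w ⊨ φ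
  recompute M φ a = stable M φ λ n → ⊥-elim-irr (n a)

  ⇒-intro : ∀ M φ ψ {w} → (M at w ⊨ φ → M at w ⊨ ψ) → M at w ⊨ φ ⇒ ψ
  ⇒-intro M φ ψ f (nnφ , nψ) = nnφ (nψ ∘ f)

  ⇒-elim : ∀ M φ ψ {w} → M at w ⊨ φ ⇒ ψ → M at w ⊨ φ → M at w ⊨ ψ
  ⇒-elim M φ ψ h a = stable M ψ λ n → h ((λ na → na a) , n)

  record Bisimulation (M N : Premodel) (_~ᴮ_ : World M → World N → Set) : Set where
    field
      V-≡   : ∀ {u v} → u ~ᴮ v → V M u ≡ V N v
      DEF-≡ : ∀ {u v} → u ~ᴮ v → DEF M u ≡ DEF N v
      forth : ∀ {i u v u′} → u ~ᴮ v → R M i u u′ → ∃ λ v′ → R N i v v′ × u′ ~ᴮ v′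
      back  : ∀ {i u v v′} → u ~ᴮ v → R N i v v′ → ∃ λ u′ → R M i u u′ × u′ ~ᴮ v′

  open Bisimulation

  _iff_ : Set → Set → Set
  A iff B = (A → B) × (B → A)

  -- For announcements, the induction hypothesis for the announced formula shows that related worlds
  -- survive together, so the same relation is a bisimulation between the two restrictions.
  bisimulation-invariance : ∀ {M N _~ᴮ_} φ → Bisimulation M N _~ᴮ_ →
    ∀ {u v} → u ~ᴮ v → (M at u ⊨ φ) iff (N at v ⊨ φ)
  bisimulation-invariance (atom p) B u~v =
    let eq = cong (λ V → V p) (V-≡ B u~v) in trans (sym eq) , trans eq
  bisimulation-invariance (P ≐ Q) B u~v =
    let eq = λ S → cong (λ D → substitute D S) (DEF-≡ B u~v)
    in  (λ h → trans (sym (eq P)) (trans h (eq Q)))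
      , (λ h → trans (eq P) (trans h (sym (eq Q))))
  bisimulation-invariance (~ φ) B u~v =
    let (to , from) = bisimulation-invariance φ B u~v in _∘ from , _∘ to
  bisimulation-invariance (φ & ψ) B u~v =
    let (to₁ , from₁) = bisimulation-invariance φ B u~v
        (to₂ , from₂) = bisimulation-invariance ψ B u~v
    in (λ (a , b) → to₁ a , to₂ b) , (λ (a , b) → from₁ a , from₂ b)
  bisimulation-invariance (□ i φ) B u~v =
      (λ h v′ r → let (u′ , r′ , u′~v′) = back B u~v r
                  in  proj₁ (bisimulation-invariance φ B u′~v′) (h u′ r′))
    , (λ h u′ r → let (v′ , r′ , u′~v′) = forth B u~v r
                  in  proj₂ (bisimulation-invariance φ B u′~v′) (h v′ r′))
  bisimulation-invariance {M} {N} {_~ᴮ_} ([ φ ] ψ) B u~v =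
      (λ h b → proj₁ (bisimulation-invariance ψ (restricted _ _) u~v)
                     (h (proj₂ (bisimulation-invariance φ B u~v) b)))
    , (λ h a → proj₂ (bisimulation-invariance ψ (restricted _ _) u~v)
                     (h (proj₁ (bisimulation-invariance φ B u~v) a)))
    where
    restricted : ∀ .w .w′ →
      Bisimulation (restrict M (λ u → M at u ⊨ φ) w) (restrict N (λ v → N at v ⊨ φ) w′)
                   (λ u v → value u ~ᴮ value v)
    restricted w w′ = record
      { V-≡   = V-≡ B
      ; DEF-≡ = DEF-≡ B
      ; forth = λ { {u′ = _ , Irrelevant.[ a ]} u~v r →
          let (v′ , r′ , u′~v′) = forth B u~v r
          in  (v′ , Irrelevant.[ proj₁ (bisimulation-invariance φ B u′~v′) a ])
            , r′ , u′~v′ }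
      ; back  = λ { {v′ = _ , Irrelevant.[ b ]} u~v r →
          let (u′ , r′ , u′~v′) = back B u~v r
          in  (u′ , Irrelevant.[ proj₂ (bisimulation-invariance φ B u′~v′) b ])
            , r′ , u′~v′ }
      }

-- Completeness for announcement-free formulas.

module Completeness (Letter : Set) (countable : Letter ↣ ℕ)
  (Agent : Set) (_≟ᴬ_ : DecidableEquality Agent)
  {Axiom : Pred (Logic.Form Letter countable Agent) 0ℓ}
  (include : ∀ {φ} → Logic.ModalDefinitionAxiom Letter countable Agent φ → Axiom φ) where

  open Logic Letter countable Agent
  open BooleanFormulas Letter countable Agent
  open Derivations Letter countable Agent include
  open Semantics Letter countable Agent
  open Premodel
  open IsModel
  open StructuralCongruence
  open MostGeneralUnifier
  open Verdict
  open DecMembership _≟_ using (_∈?_)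

  module Tree {J : Set} (label : J → Agent) (N : J → Premodel)
    (point : ∀ j → World (N j)) (v : Letter → Bool) (σ : Letter → BForm) where

    Node : Set
    Node = Maybe (Σ J (World ∘ N))

    pattern root       = nothing
    pattern inside j w = just (j , w)

    data Edge (i : Agent) : Node → Node → Set where
      enter : ∀ j → label j ≡ i → Edge i root (inside j (point j))
      step  : ∀ {j w u} → R (N j) i w u → Edge i (inside j w) (inside j u)

    -- At the root, truth factors through `σ`. Formulas with equal definitions therefore get equal
    -- values whatever `v` is, which is the first model condition.
    valuation : Node → Letter → Bool
    valuation root         = evaluate v ∘ σ
    valuation (inside j w) = V (N j) w

    definition : Node → Letter → BForm
    definition root         = σ
    definition (inside j w) = DEF (N j) w

    tree : Premodel
    tree = record
      { World = Node ; nonEmpty = root ; R = Edge ; V = valuation ; DEF = definition }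

    tree-isModel : (∀ q → substitute σ (σ q) ≡ σ q) → (∀ j → IsModel (N j)) →
      IsModel tree
    tree-isModel σσ≡σ models .def-val root P Q eq =
      trans (evaluate-substitute v σ P)
            (trans (cong (evaluate v) eq) (sym (evaluate-substitute v σ Q)))
    tree-isModel σσ≡σ models .def-val (inside j w) = def-val (models j) w
    tree-isModel σσ≡σ models .idempotent root p q = substitute-fixed (σ q) (σσ≡σ q)
    tree-isModel σσ≡σ models .idempotent (inside j w) = idempotent (models j) w

    -- Edges that start inside a component stay in it, so hanging the component below the root
    -- changes no truth value there.
    inside-bisimulation : ∀ j → Bisimulation (N j) tree (λ w u → u ≡ inside j w)
    inside-bisimulation j = record
      { V-≡   = λ { refl → refl }
      ; DEF-≡ = λ { refl → refl }
      ; forth = λ { refl r → _ , step r , refl }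
      ; back  = λ { refl (step r) → _ , r , refl }
      }

    inside-⊨ : ∀ j φ {w} → (N j at w ⊨ φ) iff (tree at inside j w ⊨ φ)
    inside-⊨ j φ = bisimulation-invariance φ (inside-bisimulation j) refl

  Satisfiable : Form → Set₁
  Satisfiable φ = Σ Premodel λ M → IsModel M × Σ (World M) λ w → M at w ⊨ φ

  -- No formula has rank 0: the rank exceeds the modal depth.
  data Rank : ℕ → Form → Set where
    atom : ∀ {n} p → Rank (suc n) (atom p)
    _≐_  : ∀ {n} P Q → Rank (suc n) (P ≐ Q)
    ~_   : ∀ {n φ} → Rank n φ → Rank n (~ φ)
    _&_  : ∀ {n φ ψ} → Rank n φ → Rank n ψ → Rank n (φ & ψ)
    □    : ∀ {n} i {φ} → Rank n φ → Rank (suc n) (□ i φ)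

  Rank-mono : ∀ {m n φ} → m ≤ n → Rank m φ → Rank n φ
  Rank-mono (s≤s _)   (atom p) = atom p
  Rank-mono (s≤s _)   (P ≐ Q)  = P ≐ Q
  Rank-mono m≤n       (~ r)    = ~ Rank-mono m≤n r
  Rank-mono m≤n       (r & s)  = Rank-mono m≤n r & Rank-mono m≤n s
  Rank-mono (s≤s m≤n) (□ i r)  = □ i (Rank-mono m≤n r)

  rank : ∀ {φ} → AnnouncementFree φ → ∃ λ n → Rank n φ
  rank (atom p) = 1 , atom p
  rank (P ≐ Q)  = 1 , P ≐ Q
  rank (~ f)    = map₂ ~_ (rank f)
  rank (f & g)  = let (m , r) = rank f ; (n , s) = rank g in
    m ⊔ n , Rank-mono (ℕ.m≤m⊔n m n) r & Rank-mono (ℕ.m≤n⊔m m n) s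
  rank (□ i f)  = let (n , r) = rank f in suc n , □ i r

  ¬Rank-0 : ∀ {φ} → ¬ Rank 0 φ
  ¬Rank-0 (~ r)   = ¬Rank-0 r
  ¬Rank-0 (r & s) = ¬Rank-0 r

  Boxed : ℕ → Set
  Boxed n = Agent × ∃ (Rank n)

  box : ∀ {n} → Boxed n → Form
  box (i , χ , _) = □ i χ

  -- Only letters outside boxes and equations are collected; with `equations` and `boxes` they are
  -- the constituents that determine truth at a world.
  freeLetters : ∀ {n φ} → Rank n φ → List Letter
  freeLetters (atom p) = p ∷ []
  freeLetters (~ r)    = freeLetters r
  freeLetters (r & s)  = freeLetters r ++ freeLetters s
  freeLetters _        = []

  equations : ∀ {n φ} → Rank n φ → Equations
  equations (P ≐ Q) = (P , Q) ∷ []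
  equations (~ r)   = equations r
  equations (r & s) = equations r ++ equations s
  equations _       = []

  boxes : ∀ {n φ} → Rank (suc n) φ → List (Boxed n)
  boxes (~ r)         = boxes r
  boxes (r & s)       = boxes r ++ boxes s
  boxes (□ i {φ} r)   = (i , φ , r) ∷ []
  boxes _             = []

  equation : BForm × BForm → Form
  equation (P , Q) = P ≐ Q

  Realised : Form → (M : Premodel) → World M → Form → Set
  Realised Γ M w φ = ((Γ ⊩ φ) × (M at w ⊨ φ)) ⊎ ((Γ ⊩ ~ φ) × ¬ (M at w ⊨ φ))

  -- The truth lemma: agreement between provability and truth extends from the constituents through
  -- negation and conjunction.
  realise : ∀ {n φ M w} (r : Rank (suc n) φ) →
    All (Realised Γ M w ∘ atom) (freeLetters r) →
    All (Realised Γ M w ∘ equation) (equations r) →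
    All (Realised Γ M w ∘ box) (boxes r) →
    Realised Γ M w φ
  realise (atom p) (h ∷ []) _ _ = h
  realise (P ≐ Q)  _ (h ∷ []) _ = h
  realise (□ i r)  _ _ (h ∷ []) = h
  realise (~ r) ls es bs with realise r ls es bs
  ... | inj₁ (d , a)  = inj₂ (~~-intro ∙ d , λ ¬a → ¬a a)
  ... | inj₂ (d , ¬a) = inj₁ (d , ¬a)
  realise (r & s) ls es bs
    with realise r (All.++⁻ˡ _ ls) (All.++⁻ˡ _ es) (All.++⁻ˡ _ bs)
       | realise s (All.++⁻ʳ (freeLetters r) ls) (All.++⁻ʳ (equations r) es)
                   (All.++⁻ʳ (boxes r) bs)
  ... | inj₁ (d , a)  | inj₁ (e , b)  = inj₁ (&-intro d e , a , b)
  ... | inj₂ (d , ¬a) | _             = inj₂ (~&-introˡ ∙ d , ¬a ∘ proj₁)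
  ... | inj₁ _        | inj₂ (e , ¬b) = inj₂ (~&-introʳ ∙ e , ¬b ∘ proj₂)

  -- What a successor must satisfy to witness the failure of `□ i ψ`: `~ ψ` and the body of every
  -- box in the list that belongs to agent `i`.
  demand : ∀ {n} → List (Boxed n) → Agent → Form → Form
  demand [] i ψ = ~ ψ
  demand ((j , χ , _) ∷ T) i ψ with j ≟ᴬ i
  ... | yes _ = χ & demand T i ψ
  ... | no _  = demand T i ψ

  demand-rank : ∀ {n} (T : List (Boxed n)) i {ψ} → Rank n ψ → Rank n (demand T i ψ)
  demand-rank [] i r = ~ r
  demand-rank ((j , _ , s) ∷ T) i r with j ≟ᴬ i
  ... | yes _ = s & demand-rank T i r
  ... | no _  = demand-rank T i r

  demand-⊭ : ∀ {n} (T : List (Boxed n)) i {ψ M w} →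
    M at w ⊨ demand T i ψ → ¬ (M at w ⊨ ψ)
  demand-⊭ [] i h = h
  demand-⊭ ((j , _) ∷ T) i h with j ≟ᴬ i
  ... | yes _ = demand-⊭ T i (proj₂ h)
  ... | no _  = demand-⊭ T i h

  demand-⊨ : ∀ {n} (T : List (Boxed n)) i {ψ M w χ} {r : Rank n χ} →
    M at w ⊨ demand T i ψ → (i , χ , r) ∈ T → M at w ⊨ χ
  demand-⊨ ((j , _) ∷ T) i h χ∈T with j ≟ᴬ i | χ∈T
  ... | yes _  | here refl = proj₁ h
  ... | yes _  | there χ∈  = demand-⊨ T i (proj₂ h) χ∈
  ... | no j≢i | here refl = contradiction refl j≢i
  ... | no _   | there χ∈  = demand-⊨ T i h χ∈

  -- Under `□ i`, the axiom K and each provable box of agent `i` discharge one conjunct of the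
  -- demand, until only `~ ~ ψ` is left.
  demand-refuted : ∀ {n} {T : List (Boxed n)} {i ψ} → All (λ b → Γ ⊩ box b) T →
    Γ ⊩ □ i (~ demand T i ψ) → Γ ⊩ □ i ψ
  demand-refuted [] d = □-map ~~-elim ∙ d
  demand-refuted {T = (j , _) ∷ T} {i} (t ∷ ts) d with j ≟ᴬ i
  ... | yes refl = demand-refuted ts (□-ap (□-map ~&-elim ∙ d) t)
  ... | no _     = demand-refuted ts d

  all-or-some : ∀ {A : Set} {P : A → Set₁} {X : Set} {L : List A} →
    All (λ a → P a ⊎ X) L → All P L ⊎ X
  all-or-some [] = inj₁ []
  all-or-some (inj₂ x ∷ _) = inj₂ x
  all-or-some (inj₁ p ∷ ps) with all-or-some ps
  ... | inj₁ ps′ = inj₁ (p ∷ ps′)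
  ... | inj₂ x   = inj₂ x

  -- The tree model of a context that decides all constituents.

  module Realisation {n φ Γ} (r : Rank (suc n) φ)
    (E : Verdict Γ equation (equations r))
    (mgu : MostGeneralUnifier (accepted E))
    (L : Verdict Γ atom (concatMap (letters ∘ unifier mgu) (freeLetters r)))
    (B : Verdict Γ box (boxes r))
    (children : All (λ (i , ψ , _) → Satisfiable (demand (accepted B) i ψ)) (rejected B))
    where

    σ : Letter → BForm
    σ = unifier mgu

    J : Set
    J = ∃ (_∈ rejected B)

    child : ((b , _) : J) →
      Satisfiable (demand (accepted B) (proj₁ b) (proj₁ (proj₂ b)))
    child (_ , b∈) = All.lookup children b∈

    -- A letter listed twice may be accepted once and rejected once; acceptance then wins. Letters
    -- outside the list are false.
    v : Letter → Bool
    v q = does (q ∈? accepted L)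

    open Tree {J} (proj₁ ∘ proj₁) (proj₁ ∘ child)
      (λ j → proj₁ (proj₂ (proj₂ (child j)))) v σ

    model : IsModel tree
    model = tree-isModel (unifier-idempotent mgu) (λ j → proj₁ (proj₂ (child j)))

    σ-provable : ∀ q → Γ ⊩ atom q ≐ σ q
    σ-provable = general mgu (provable-congruence Γ) (accepts E)

    -- The unifier decides, not the verdict: an equation it satisfies is provable by `≈-reflect`,
    -- and one it violates cannot have been accepted.
    realise-equation : ∀ {P Q} → (P , Q) ∈ equations r →
      Realised Γ tree root (P ≐ Q)
    realise-equation {P} {Q} ∈E with substitute σ P ≟ᴮ substitute σ Q
    ... | yes eq = inj₁ (≈-reflect (provable-congruence Γ) σ-provable P Q eq , eq)
    ... | no neq with All.lookup (covers E) ∈E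
    ...   | inj₁ ∈acc = contradiction (All.lookup (unifies mgu) ∈acc) neq
    ...   | inj₂ ∈rej = inj₂ (All.lookup (rejects E) ∈rej , neq)

    evaluated : ∀ P → (∀ {x} → x occursIn P →
        x ∈ concatMap (letters ∘ σ) (freeLetters r)) →
      ((Γ ⊩ ⌜ P ⌝) × evaluate v P ≡ true) ⊎ ((Γ ⊩ ~ ⌜ P ⌝) × evaluate v P ≡ false)
    evaluated (atom q) q∈ with q ∈? accepted L
    ... | yes ∈acc = inj₁ (All.lookup (accepts L) ∈acc , refl)
    ... | no ∉acc with All.lookup (covers L) (q∈ here)
    ...   | inj₁ ∈acc = contradiction ∈acc ∉acc
    ...   | inj₂ ∈rej = inj₂ (All.lookup (rejects L) ∈rej , refl)
    evaluated (~ P) x∈ with evaluated P (x∈ ∘ neg)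
    ... | inj₁ (d , eq) = inj₂ (~~-intro ∙ d , cong not eq)
    ... | inj₂ (d , eq) = inj₁ (d , cong not eq)
    evaluated (P & Q) x∈ with evaluated P (x∈ ∘ left) | evaluated Q (x∈ ∘ right)
    ... | inj₁ (d , eq) | inj₁ (e , eq′) = inj₁ (&-intro d e , cong₂ _∧_ eq eq′)
    ... | inj₂ (d , eq) | _ = inj₂ (~&-introˡ ∙ d , cong (_∧ evaluate v Q) eq)
    ... | inj₁ (_ , eq) | inj₂ (e , eq′) = inj₂ (~&-introʳ ∙ e , cong₂ _∧_ eq eq′)

    -- The truth of `p` at the root is that of `σ p` under `v`, and the equivalence axiom carries
    -- provability from `σ p` to `p`.
    realise-letter : ∀ {p} → p ∈ freeLetters r → Realised Γ tree root (atom p)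
    realise-letter {p} p∈ with evaluated (σ p)
      (λ o → ∈-concat⁺′ (occursIn⇒∈letters o) (∈-map⁺ (letters ∘ σ) p∈))
    ... | inj₁ (d , eq) = inj₁ (&-elimʳ ∙ p⇔σp · d , eq)
      where p⇔σp = definitional (equivalence _ _) ∙ σ-provable p
    ... | inj₂ (d , eq) = inj₂ (modus-tollens (&-elimˡ ∙ p⇔σp) d ,
                                λ eq′ → case trans (sym eq) eq′ of λ ())
      where p⇔σp = definitional (equivalence _ _) ∙ σ-provable p

    realise-box : ∀ {b} → b ∈ boxes r → Realised Γ tree root (box b)
    realise-box {i , χ , _} ∈B with All.lookup (covers B) ∈B
    -- Every `i`-edge from the root enters a child built for a rejected box of agent `i`, whose
    -- demand contains `χ`.
    ... | inj₁ ∈acc = inj₁ (All.lookup (accepts B) ∈acc , λ where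
            _ (enter j refl) → proj₁ (inside-⊨ j χ)
              (demand-⊨ (accepted B) i (proj₂ (proj₂ (proj₂ (child j)))) ∈acc))
    -- The child built for this very box refutes `χ`.
    ... | inj₂ ∈rej = inj₂ (All.lookup (rejects B) ∈rej , λ h →
            let j = _ , ∈rej
            in  demand-⊭ (accepted B) i (proj₂ (proj₂ (proj₂ (child j))))
                  (proj₂ (inside-⊨ j χ) (h _ (enter j refl))))

    satisfied : Γ ⊩ φ → Satisfiable φ ⊎ (⊢ ~ Γ)
    satisfied d with realise r (All.tabulate realise-letter)
      (All.tabulate realise-equation) (All.tabulate realise-box)
    ... | inj₁ (_ , h) = inj₁ (tree , model , root , h)
    ... | inj₂ (e , _) = inj₂ (inconsistent d e)

  -- Equations are decided first, because the letters to be decided next are those in the values of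
  -- their unifier. Boxes come last, and their demands have the smaller rank `n`.
  satisfiable-or-refutable : ∀ n {φ} → Rank n φ → Satisfiable φ ⊎ (⊢ ~ φ)
  satisfiable-or-refutable zero r = ⊥-elim (¬Rank-0 r)
  satisfiable-or-refutable (suc n) {φ} r =
    decide-all equation (equations r) φ λ Γ₁ Γ₁⊩φ E →
    case unify (accepted E) of λ where
      (inj₁ clash) → inj₂ (clash-refutes (clash (provable-congruence Γ₁) (accepts E)))
      (inj₂ mgu) →
        decide-all atom (concatMap (letters ∘ unifier mgu) (freeLetters r)) Γ₁ λ Γ₂ Γ₂⊩Γ₁ L →
        decide-all box (boxes r) Γ₂ λ Γ₃ Γ₃⊩Γ₂ B →
        case all-or-some (All.tabulate (child B)) of λ where
          (inj₁ children) → Realisation.satisfied r (strengthen (Γ₂⊩Γ₁ ∙ Γ₃⊩Γ₂) E) mgu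
            (strengthen Γ₃⊩Γ₂ L) B children (Γ₁⊩φ ∙ (Γ₂⊩Γ₁ ∙ Γ₃⊩Γ₂))
          (inj₂ refuted) → inj₂ refuted
    where
    child : (B : Verdict Γ box (boxes r)) → ∀ {b@(i , ψ , _) : Boxed n} → b ∈ rejected B →
      Satisfiable (demand (accepted B) i ψ) ⊎ (⊢ ~ Γ)
    child B {i , ψ , s} b∈ with satisfiable-or-refutable n (demand-rank (accepted B) i s)
    ... | inj₁ sat = inj₁ sat
    -- A refuted demand makes `□ i ψ` provable by necessitation, although the context rejects it.
    ... | inj₂ d   = inj₂ (inconsistent
      (demand-refuted (accepts B) (weaken (necessitation i d)))
      (All.lookup (rejects B) b∈))

  complete : ∀ {φ} → AnnouncementFree φ → Valid φ → ⊢ φ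
  complete f valid with satisfiable-or-refutable _ (proj₂ (rank (~ f)))
  ... | inj₁ (M , model , w , w⊭φ) = contradiction (valid M model w) w⊭φ
  ... | inj₂ d                     = by₁ ~~-elim d

-- Elimination of announcements.

module Reduction (Letter : Set) (countable : Letter ↣ ℕ) (Agent : Set) where
  open Logic Letter countable Agent
  open Derivations Letter countable Agent {ModalDefinitionAxiom ∪ ReductionAxiom} inj₁
  open Semantics Letter countable Agent
  open Premodel

  infix 2 _≈_

  -- The semantic half transfers validity to the reduct without appeal to soundness of the calculus;
  -- the provable half brings the derivation back.
  record _≈_ (φ ψ : Form) : Set₁ where
    field
      provable : φ ⊣⊢ ψ
      semantic : ∀ M {w} → (M at w ⊨ φ) iff (M at w ⊨ ψ)

  open _≈_ public

  ≈-trans : φ ≈ ψ → ψ ≈ θ → φ ≈ θ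
  ≈-trans e f = record
    { provable = proj₁ (provable f) ∙ proj₁ (provable e)
               , proj₂ (provable e) ∙ proj₂ (provable f)
    ; semantic = λ M → proj₁ (semantic f M) ∘ proj₁ (semantic e M)
                     , proj₂ (semantic e M) ∘ proj₂ (semantic f M)
    }

  ~-cong : φ ≈ ψ → ~ φ ≈ ~ ψ
  ~-cong e = record
    { provable = contrapositive (proj₂ (provable e)) , contrapositive (proj₁ (provable e))
    ; semantic = λ M → _∘ proj₂ (semantic e M) , _∘ proj₁ (semantic e M)
    }

  &-cong : φ ≈ ψ → θ ≈ χ → φ & θ ≈ ψ & χ
  &-cong e f = record
    { provable =
          &-intro (proj₁ (provable e) ∙ &-elimˡ) (proj₁ (provable f) ∙ &-elimʳ)
        , &-intro (proj₂ (provable e) ∙ &-elimˡ) (proj₂ (provable f) ∙ &-elimʳ)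
    ; semantic = λ M →
          (λ (a , b) → proj₁ (semantic e M) a , proj₁ (semantic f M) b)
        , (λ (a , b) → proj₂ (semantic e M) a , proj₂ (semantic f M) b)
    }

  □-cong : ∀ i → φ ≈ ψ → □ i φ ≈ □ i ψ
  □-cong i e = record
    { provable = □-map (proj₁ (provable e)) , □-map (proj₂ (provable e))
    ; semantic = λ M →
          (λ h v r → proj₁ (semantic e M) (h v r))
        , (λ h v r → proj₂ (semantic e M) (h v r))
    }

  ≈-reduction : ReductionAxiom (φ ⇔ ψ) →
    (∀ M {w} → (M at w ⊨ φ) iff (M at w ⊨ ψ)) → φ ≈ ψ
  ≈-reduction a s = record { provable = from-⇔ (axiom (inj₂ a)) ; semantic = s }

  ≈-atom : ∀ φ p → [ φ ] (atom p) ≈ φ ⇒ atom p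
  ≈-atom φ p = ≈-reduction (announce-atom φ p) λ M →
    ⇒-intro M φ (atom p) , ⇒-elim M φ (atom p)

  ≈-≐ : ∀ φ P Q → [ φ ] (P ≐ Q) ≈ φ ⇒ (P ≐ Q)
  ≈-≐ φ P Q = ≈-reduction (announce-≐ φ P Q) λ M →
    ⇒-intro M φ (P ≐ Q) , ⇒-elim M φ (P ≐ Q)

  ≈-~ : ∀ φ ψ → [ φ ] (~ ψ) ≈ φ ⇒ ~ ([ φ ] ψ)
  ≈-~ φ ψ = ≈-reduction (announce-~ φ ψ) λ M →
      (λ h → ⇒-intro M φ (~ ([ φ ] ψ)) λ a k → h a (k a))
    , (λ h a b → ⇒-elim M φ (~ ([ φ ] ψ)) h a λ _ → b)

  ≈-& : ∀ φ ψ θ → [ φ ] (ψ & θ) ≈ ([ φ ] ψ) & ([ φ ] θ)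
  ≈-& φ ψ θ = ≈-reduction (announce-& φ ψ θ) λ M →
      (λ h → proj₁ ∘ h , proj₂ ∘ h)
    , (λ (h , k) a → h a , k a)

  ≈-□ : ∀ φ i ψ → [ φ ] (□ i ψ) ≈ φ ⇒ □ i (φ ⇒ ([ φ ] ψ))
  ≈-□ φ i ψ = ≈-reduction (announce-□ φ i ψ) λ M →
      (λ h → ⇒-intro M φ (□ i (φ ⇒ ([ φ ] ψ))) λ a v r →
        ⇒-intro M φ ([ φ ] ψ) λ b _ → h a (v , Irrelevant.[ b ]) r)
    , (λ { h a (v , Irrelevant.[ b ]) r →
        let b′ = recompute M φ b
        in  ⇒-elim M φ ([ φ ] ψ) (⇒-elim M φ (□ i (φ ⇒ ([ φ ] ψ))) h a v r) b′ b′ })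

  -- Restricting twice and restricting once to the conjunction keep the same worlds, packaged
  -- differently; having the same underlying world is a bisimulation between the two.
  ≈-announce : ∀ φ ψ ξ → [ φ ] ([ ψ ] ξ) ≈ [ φ & ([ φ ] ψ) ] ξ
  ≈-announce φ ψ ξ = ≈-reduction (announce-announce φ ψ ξ) λ M →
      (λ h (a , b) → proj₁ (bisimulation-invariance ξ (iterated M a (b a)) refl) (h a (b a)))
    , (λ h a b → proj₂ (bisimulation-invariance ξ (iterated M a b) refl) (h (a , λ _ → b)))
    where
    iterated : ∀ M {w} (a : M at w ⊨ φ)
      (b : restrict M (λ v → M at v ⊨ φ) (w , Irrelevant.[ a ]) at (w , Irrelevant.[ a ]) ⊨ ψ) →
      let Mᵠ = restrict M (λ v → M at v ⊨ φ) (w , Irrelevant.[ a ]) in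
      Bisimulation
        (restrict Mᵠ (λ v → Mᵠ at v ⊨ ψ) ((w , Irrelevant.[ a ]) , Irrelevant.[ b ]))
        (restrict M (λ v → M at v ⊨ φ & ([ φ ] ψ)) (w , Irrelevant.[ a , (λ _ → b) ]))
        (λ u v → value (value u) ≡ value v)
    iterated M a b = record
      { V-≡   = cong (V M)
      ; DEF-≡ = cong (DEF M)
      ; forth = λ { {u′ = (x , Irrelevant.[ c ]) , Irrelevant.[ d ]} refl r →
          (x , Irrelevant.[ c , (λ _ → d) ]) , r , refl }
      ; back  = λ { {v′ = x , Irrelevant.[ c ]} refl r →
          ((x , Irrelevant.[ proj₁ c ]) , Irrelevant.[ proj₂ c (proj₁ c) ]) , r , refl }
      }

  record Reducible (φ : Form) : Set₁ where
    field
      {reduct}   : Form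
      free       : AnnouncementFree reduct
      equivalent : φ ≈ reduct

  open Reducible public

  _≈∘_ : φ ≈ ψ → Reducible ψ → Reducible φ
  e ≈∘ r = record { free = free r ; equivalent = ≈-trans e (equivalent r) }

  irreducible : AnnouncementFree φ → Reducible φ
  irreducible f = record { free = f ; equivalent = record
    { provable = assumption , assumption ; semantic = λ M → id , id } }

  ~-reducible : Reducible φ → Reducible (~ φ)
  ~-reducible r = record { free = ~ free r ; equivalent = ~-cong (equivalent r) }

  &-reducible : Reducible φ → Reducible ψ → Reducible (φ & ψ)
  &-reducible r s = record
    { free = free r & free s ; equivalent = &-cong (equivalent r) (equivalent s) }

  □-reducible : ∀ i → Reducible φ → Reducible (□ i φ)
  □-reducible i r = record { free = □ i (free r) ; equivalent = □-cong i (equivalent r) }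

  ⇒-reducible : Reducible φ → Reducible ψ → Reducible (φ ⇒ ψ)
  ⇒-reducible r s = ~-reducible (&-reducible (~-reducible (~-reducible r)) (~-reducible s))

  announcement-reducible : ∀ ψ → Reducible φ → Reducible ([ φ ] ψ)
  announcement-reducible (atom p)  r = ≈-atom _ p ≈∘ ⇒-reducible r (irreducible (atom p))
  announcement-reducible (P ≐ Q)   r = ≈-≐ _ P Q ≈∘ ⇒-reducible r (irreducible (P ≐ Q))
  announcement-reducible (~ ψ)     r =
    ≈-~ _ ψ ≈∘ ⇒-reducible r (~-reducible (announcement-reducible ψ r))
  announcement-reducible (ψ & θ)   r =
    ≈-& _ ψ θ ≈∘ &-reducible (announcement-reducible ψ r) (announcement-reducible θ r)
  announcement-reducible (□ i ψ)   r =
    ≈-□ _ i ψ ≈∘ ⇒-reducible r (□-reducible i (⇒-reducible r (announcement-reducible ψ r)))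
  announcement-reducible ([ ψ ] ξ) r =
    -- The announced formula grows, but the recursion is on `ξ` and only needs the new announcement
    -- to be reducible, which the recursive call on `ψ` provides.
    ≈-announce _ ψ ξ ≈∘ announcement-reducible ξ (&-reducible r (announcement-reducible ψ r))

  reducible : ∀ φ → Reducible φ
  reducible (atom p)  = irreducible (atom p)
  reducible (P ≐ Q)   = irreducible (P ≐ Q)
  reducible (~ φ)     = ~-reducible (reducible φ)
  reducible (φ & ψ)   = &-reducible (reducible φ) (reducible ψ)
  reducible (□ i φ)   = □-reducible i (reducible φ)
  reducible ([ φ ] ψ) = announcement-reducible ψ (reducible φ)

theorem2 : (Letter : Set) (countable : Letter ↣ ℕ)
    (Agent : Set) (n : ℕ) (finite : Agent ↔ Fin n) →
    let open Logic Letter countable Agent in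
    (∀ φ → AnnouncementFree φ → Valid φ → SMLD⊢ φ) ×
    (∀ φ → Valid φ → SPALD⊢ φ)
theorem2 Letter countable Agent n finite =
    (λ φ → Completeness.complete Letter countable Agent _≟ᴬ_ id)
  -- The reduct inherits validity, is provable by completeness for announcement-free formulas, and
  -- provably implies `φ`.
  , (λ φ valid → let r = reducible φ ; e = equivalent r in
      modus-ponens
        (Completeness.complete Letter countable Agent _≟ᴬ_ inj₁ (free r)
          λ M model w → proj₁ (semantic e M) (valid M model w))
        (proj₂ (provable e)))
  where
  open Logic Letter countable Agent
  open Reduction Letter countable Agent

  _≟ᴬ_ : DecidableEquality Agent
  _≟ᴬ_ = via-injection (↔⇒↣ finite) Fin._≟_
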